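{- Let $\mathcal{F}$ be a class of simple graphs and consider the assertions: (1) $\mathcal{F}$ is closed under deleting edges; (2) $\equiv_{\mathcal{F}}$ is preserved under taking full complements, i.e.\ for all simple graphs $G$ and $H$ it holds that $G\equiv_{\mathcal{F}}H$ if and only if $\widehat{G}\equiv_{\mathcal{F}}\widehat{H}$; (3) $\mathrm{cl}(\mathcal{F})$ is closed under deleting edges; (4) $\mathrm{cl}(\mathcal{F})$ is closed under taking subgraphs, i.e.\ under deleting edges and vertices; (5) $\equiv_{\mathrm{cl}(\mathcal{F})}$ is preserved under taking full complements. Then (1) implies (2), (2) implies (3), and (3), (4), (5) are pairwise equivalent.
   Context: Graphs are finite, undirected, without multiple edges, possibly with loops; simple means without loops. A homomorphism maps edges to edges (possibly loops) and looped vertices to looped vertices; $\hom(F,G)$ counts homomorphisms. $G\equiv_{\mathcal{F}}H$ means $\hom(F,G)=\hom(F,H)$ for all $F\in\mathcal{F}$. $\mathrm{cl}(\mathcal{F})$ is the class of all simple graphs $K$ such that for all simple $G,H$, $G\equiv_{\mathcal{F}}H$ implies $\hom(K,G)=\hom(K,H)$. The full complement $\widehat{G}$ of a graph $G$ has vertex set $V(G)$; for distinct $u,v$, $uv$ is an edge of $\widehat G$ iff it is not an edge of $G$, and $v$ has a loop in $\widehat G$ iff it has no loop in $G$. -}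

module Defs where

open import Level using (Level)
open import Data.Bool using (Bool; not; T; T?)
open import Data.Fin using (Fin; finToFun)
open import Data.Fin.Properties using (all?)
open import Data.List using (allFin; filter; length)
open import Data.Nat using (ℕ; _^_)
open import Data.Product using (_×_; ∃)
open import Function.Bundles using (_⇔_)
open import Function.Definitions using (Injective)
open import Relation.Binary.PropositionalEquality using (_≡_; cong)
open import Relation.Nullary.Decidable using (Dec; _→-dec_)
open import Relation.Nullary.Negation using (¬_)

-- Loops are allowed: v has a loop when adj v v is true.
record Graph (n : ℕ) : Set where
  field
    adj     : Fin n → Fin n → Bool
    adj-sym : ∀ u v → adj u v ≡ adj v u

  Edge : Fin n → Fin n → Set
  Edge u v = T (adj u v)

open Graph public

Simple : ∀ {n} → Graph n → Set
Simple G = ∀ v → ¬ Edge G v v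

-- The cases u ≡ v say that looped vertices are sent to looped vertices.
IsHom : ∀ {m n} → Graph m → Graph n → (Fin m → Fin n) → Set
IsHom F G f = ∀ u v → Edge F u v → Edge G (f u) (f v)

isHom? : ∀ {m n} (F : Graph m) (G : Graph n) f → Dec (IsHom F G f)
isHom? F G f = all? λ u → all? λ v → T? _ →-dec T? _

-- finToFun enumerates every map Fin m → Fin n exactly once (up to pointwise
-- equality) as its argument ranges over Fin (n ^ m).
hom : ∀ {m n} → Graph m → Graph n → ℕ
hom {m} {n} F G = length (filter (λ i → isHom? F G (finToFun i)) (allFin (n ^ m)))

-- Off the diagonal not swaps edges and non-edges; on it, loops and their absence.
fullComplement : ∀ {n} → Graph n → Graph n
fullComplement G .adj u v     = not (adj G u v)
fullComplement G .adj-sym u v = cong not (adj-sym G u v)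

-- Closure under isomorphism is not required of a class.
GraphClass : (ℓ : Level) → Set (Level.suc ℓ)
GraphClass ℓ = ∀ {n} → Graph n → Set ℓ

ClassOfSimpleGraphs : ∀ {ℓ} → GraphClass ℓ → Set ℓ
ClassOfSimpleGraphs 𝓕 = ∀ {n} (K : Graph n) → 𝓕 K → Simple K

HomIndist : ∀ {ℓ} → GraphClass ℓ → ∀ {m n} → Graph m → Graph n → Set ℓ
HomIndist 𝓕 G H = ∀ {k} (F : Graph k) → 𝓕 F → hom F G ≡ hom F H

cl : ∀ {ℓ} → GraphClass ℓ → GraphClass ℓ
cl 𝓕 K = Simple K ×
  (∀ {m n} (G : Graph m) (H : Graph n) → Simple G → Simple H →
    HomIndist 𝓕 G H → hom K G ≡ hom K H)

-- L arises from K by deleting a set of edges, keeping all vertices.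
IsEdgeDeletion : ∀ {n} → Graph n → Graph n → Set
IsEdgeDeletion L K = ∀ u v → Edge L u v → Edge K u v

-- Deleting vertices changes the index n, so the vertices of a subgraph have to
-- be renumbered: L is a subgraph of K along an injection of vertices that maps
-- edges of L to edges of K (and need not reflect them).
IsSubgraph : ∀ {m n} → Graph m → Graph n → Set
IsSubgraph L K = ∃ λ f → Injective _≡_ _≡_ f × IsHom L K f

ClosedUnderDeletingEdges : ∀ {ℓ} → GraphClass ℓ → Set ℓ
ClosedUnderDeletingEdges 𝓕 =
  ∀ {n} (K L : Graph n) → IsEdgeDeletion L K → 𝓕 K → 𝓕 L

ClosedUnderSubgraphs : ∀ {ℓ} → GraphClass ℓ → Set ℓ
ClosedUnderSubgraphs 𝓕 =
  ∀ {m n} (K : Graph n) (L : Graph m) → IsSubgraph L K → 𝓕 K → 𝓕 L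

PreservedUnderFullComplements : ∀ {ℓ} → GraphClass ℓ → Set ℓ
PreservedUnderFullComplements 𝓕 =
  ∀ {m n} (G : Graph m) (H : Graph n) → Simple G → Simple H →
    HomIndist 𝓕 G H ⇔ HomIndist 𝓕 (fullComplement G) (fullComplement H)

{-# OPTIONS --safe #-}

-- (1) ⇒ (2): maps that send A to edges and B to non-edges are counted by induction on B:
-- those for (A , B) split into those for (A , e ∷ B) and those for (A + e , B).  Hence
-- hom(F, Ĝ) is determined by the numbers hom(F′, G) with F′ an edge deletion of F.
--
-- (2) ⇒ (3): let K ∈ cl(𝓕), L ⊆ K and G ≡ H.  Multiplying by X and complementing both preserve
-- ≡, so K cannot distinguish the complements of Ĝ × X and Ĥ × X.  For X = L[xs], the subgraph of
-- L induced by xs, this says that Σ hom(K ∩ φ⁻¹(L), G) over all φ : V(K) → xs does not change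
-- when G is replaced by H.  Inclusion–exclusion over xs gives the same for the sum over all
-- bijective φ.  There a term either equals hom(L, G), namely if φ⁻¹(L) ⊆ K, as for φ = id, or
-- K ∩ φ⁻¹(L) has fewer edges than L; induction on the number of edges gives hom(L, G) = hom(L, H).
--
-- (3) ⇒ (4): vertices are deleted one at a time.  With j isolated instead of deleted, the number
-- of homomorphisms is |G| · hom(K - j, G), and |G| = |H| since cl(𝓕) contains an edgeless graph.
-- (5) ⇒ (3) is (2) ⇒ (3) for cl(𝓕), because cl(cl(𝓕)) = cl(𝓕).
module Submission where

open import Defs
open import Level using (Level)
open import Algebra.Properties.CommutativeSemigroup using (interchange; x∙yz≈y∙xz)
open import Data.Bool using (_∧_; true; false; not; if_then_else_; T)
open import Data.Bool.Properties using (not-involutive)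
open import Data.Fin
  using (Fin; zero; suc; quotient; remainder; combine; finToFun; funToFin; punchIn; punchOut)
open import Data.Fin.Properties
  using (_≟_; all?; any?; ¬∀⟶∃¬; injective⇒≤; combine-remQuot; remQuot-combine;
         finToFun-funToFin; funToFin-finToFin; punchIn-punchOut; punchInᵢ≢i; punchOut-injective)
open import Data.List
  using (List; []; _∷_; _++_; map; filter; length; allFin; cartesianProduct; cartesianProductWith)
import Data.List as List
open import Data.List.Membership.Propositional using (_∈_)
open import Data.List.Membership.Propositional.Properties
open import Data.List.Membership.Propositional.Properties.WithK using (unique∧set⇒bag)
open import Data.List.Properties using (map-∘; map-cong; map-++; length-tabulate)
open import Data.List.Relation.Binary.BagAndSetEquality using (∼bag⇒↭)
open import Data.List.Relation.Binary.Permutation.Propositional using (_↭_)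
open import Data.List.Relation.Binary.Permutation.Propositional.Properties using (map⁺)
import Data.List.Relation.Unary.All as All
open import Data.List.Relation.Unary.All.Properties using () renaming (all-filter to All-filter)
open import Data.List.Relation.Unary.AllPairs using ([]; _∷_)
open import Data.List.Relation.Unary.Any using (here; there; index)
open import Data.List.Relation.Unary.Any.Properties using (lookup-index)
open import Data.List.Relation.Unary.Unique.Propositional using (Unique)
import Data.List.Relation.Unary.Unique.Propositional.Properties as Unique
open import Data.Nat using (ℕ; zero; suc; _+_; _*_; _^_; _≤_; _<_; z≤n; s≤s; z<s; NonZero; >-nonZero)
open import Data.Nat.ListAction using (sum)
open import Data.Nat.ListAction.Properties using (sum-++; sum-↭)
open import Data.Nat.Properties hiding (_≟_)
open import Data.Product using (_×_; _,_; ∃; proj₁; proj₂)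
open import Data.Sum using (_⊎_; inj₁; inj₂; [_,_]′)
open import Data.Vec using (Vec; []; _∷_; lookup; tabulate; zipWith; insertAt; removeAt)
import Data.Vec as Vec
open import Data.Vec.Properties
  using (lookup∘tabulate; tabulate∘lookup; tabulate-cong; lookup-zipWith; lookup-map; ∷-injective;
         insertAt-lookup; insertAt-punchIn; insertAt-removeAt; removeAt-insertAt)
open import Function using (_∘_; id)
open import Function.Bundles using (_⇔_; mk⇔; Equivalence)
open import Function.Definitions using (Injective)
open import Relation.Binary using (tri<; tri≈; tri>)
open import Relation.Binary.PropositionalEquality
  using (_≡_; _≢_; _≗_; refl; sym; trans; cong; cong₂; subst; subst₂; module ≡-Reasoning)
open import Relation.Nullary using (¬_; Dec; yes; no; does; contradiction)
open import Relation.Nullary.Decidable using (does-⇔; decidable-stable; T?; _×-dec_; _→-dec_; _⊎-dec_; ¬?)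
open import Relation.Unary using (Pred; Decidable)

private
  variable
    a b ℓ : Level
    A B : Set a
    k m n p q : ℕ

-- Finite sums over lists.

infixr 8 ∑
∑ : List A → (A → ℕ) → ℕ
∑ xs w = sum (map w xs)

syntax ∑ xs (λ x → w) = ∑[ x ∈ xs ] w

∑-cong : (xs : List A) {w w′ : A → ℕ} → w ≗ w′ → ∑ xs w ≡ ∑ xs w′
∑-cong xs eq = cong sum (map-cong eq xs)

∑-map : (f : A → B) (xs : List A) (w : B → ℕ) → ∑ (map f xs) w ≡ ∑ xs (w ∘ f)
∑-map f xs w = cong sum (sym (map-∘ xs))

∑-++ : (xs ys : List A) (w : A → ℕ) → ∑ (xs ++ ys) w ≡ ∑ xs w + ∑ ys w
∑-++ xs ys w = trans (cong sum (map-++ w xs ys)) (sum-++ (map w xs) _)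

∑-↭ : {xs ys : List A} → xs ↭ ys → (w : A → ℕ) → ∑ xs w ≡ ∑ ys w
∑-↭ σ w = sum-↭ (map⁺ w σ)

∑-+ : (xs : List A) (w w′ : A → ℕ) → ∑[ x ∈ xs ] (w x + w′ x) ≡ ∑ xs w + ∑ xs w′
∑-+ []       w w′ = refl
∑-+ (x ∷ xs) w w′ =
  trans (cong (w x + w′ x +_) (∑-+ xs w w′))
    (interchange +-commutativeSemigroup (w x) (w′ x) (∑ xs w) (∑ xs w′))

∑-*ʳ : (xs : List A) (w : A → ℕ) (c : ℕ) → ∑[ x ∈ xs ] (w x * c) ≡ ∑ xs w * c
∑-*ʳ []       w c = refl
∑-*ʳ (x ∷ xs) w c = trans (cong (w x * c +_) (∑-*ʳ xs w c)) (sym (*-distribʳ-+ c (w x) _))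

∑-*ˡ : (xs : List A) (c : ℕ) (w : A → ℕ) → ∑[ x ∈ xs ] (c * w x) ≡ c * ∑ xs w
∑-*ˡ xs c w = trans (∑-cong xs λ x → *-comm c (w x)) (trans (∑-*ʳ xs w c) (*-comm _ c))

∑-const : (xs : List A) (c : ℕ) → ∑[ x ∈ xs ] c ≡ length xs * c
∑-const []       c = refl
∑-const (x ∷ xs) c = cong (c +_) (∑-const xs c)

∑-cartesianProduct : (xs : List A) (ys : List B) (w : A × B → ℕ) →
  ∑ (cartesianProduct xs ys) w ≡ ∑[ x ∈ xs ] ∑[ y ∈ ys ] w (x , y)
∑-cartesianProduct []       ys w = refl
∑-cartesianProduct (x ∷ xs) ys w =
  trans (∑-++ (map (x ,_) ys) _ w)
    (cong₂ _+_ (∑-map (x ,_) ys w) (∑-cartesianProduct xs ys w))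

∑-partition : {P : Pred A ℓ} (P? : Decidable P) (xs : List A) (w : A → ℕ) →
  ∑ (filter P? xs) w + ∑ (filter (¬? ∘ P?) xs) w ≡ ∑ xs w
∑-partition P? []       w = refl
∑-partition P? (x ∷ xs) w with P? x
... | yes _ = trans (+-assoc (w x) _ _) (cong (w x +_) (∑-partition P? xs w))
... | no  _ = trans
  (x∙yz≈y∙xz +-commutativeSemigroup (∑ (filter P? xs) w) (w x) (∑ (filter (¬? ∘ P?) xs) w))
  (cong (w x +_) (∑-partition P? xs w))

∑-mono-≤ : (xs : List A) {w w′ : A → ℕ} → (∀ {x} → x ∈ xs → w x ≤ w′ x) → ∑ xs w ≤ ∑ xs w′
∑-mono-≤ []       le = z≤n
∑-mono-≤ (x ∷ xs) le = +-mono-≤ (le (here refl)) (∑-mono-≤ xs (le ∘ there))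

∑-mono-< : (xs : List A) {w w′ : A → ℕ} → (∀ {x} → x ∈ xs → w x ≤ w′ x) →
  ∀ {y} → y ∈ xs → w y < w′ y → ∑ xs w < ∑ xs w′
∑-mono-< (x ∷ xs) le (here refl) lt = +-mono-<-≤ lt (∑-mono-≤ xs (le ∘ there))
∑-mono-< (x ∷ xs) le (there y∈)  lt = +-mono-≤-< (le (here refl)) (∑-mono-< xs (le ∘ there) y∈ lt)

∈⇒≤∑ : {xs : List A} {x : A} (w : A → ℕ) → x ∈ xs → w x ≤ ∑ xs w
∈⇒≤∑ w (here refl) = m≤m+n (w _) _
∈⇒≤∑ {xs = x ∷ xs} w (there x∈) = ≤-trans (∈⇒≤∑ w x∈) (m≤n+m _ (w x))

unique∧set⇒↭ : {xs ys : List A} → Unique xs → Unique ys →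
  (∀ {x} → x ∈ xs → x ∈ ys) → (∀ {x} → x ∈ ys → x ∈ xs) → xs ↭ ys
unique∧set⇒↭ xs! ys! to from = ∼bag⇒↭ (unique∧set⇒bag xs! ys! (mk⇔ to from))

-- `map f xs` and `ys` are duplicate-free with the same members, hence permutations of each other.
-- The bijective changes of summation variable below go through this lemma.
∑-reindex : {xs : List A} {ys : List B} (f : A → B) → Unique xs → Unique ys →
  (∀ {x x′} → f x ≡ f x′ → x ≡ x′) →
  (∀ {x} → x ∈ xs → f x ∈ ys) → (∀ {y} → y ∈ ys → ∃ λ x → x ∈ xs × y ≡ f x) →
  (w : B → ℕ) → ∑ xs (w ∘ f) ≡ ∑ ys w
∑-reindex {xs = xs} {ys} f xs! ys! inj into onto w =
  trans (sym (∑-map f xs w)) (∑-↭ (unique∧set⇒↭ (Unique.map⁺ inj xs!) ys! to from) w)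
  where
  to : ∀ {y} → y ∈ map f xs → y ∈ ys
  to y∈ with _ , x∈ , refl ← ∈-map⁻ f y∈ = into x∈
  from : ∀ {y} → y ∈ ys → y ∈ map f xs
  from y∈ with _ , x∈ , refl ← onto y∈ = ∈-map⁺ f x∈

-- Iverson brackets of decidable propositions.

⟦_⟧ : {P : Set ℓ} → Dec P → ℕ
⟦ d ⟧ = if does d then 1 else 0

⟦⟧-cong : {P : Set a} {Q : Set b} (p : Dec P) (q : Dec Q) → (P → Q) → (Q → P) → ⟦ p ⟧ ≡ ⟦ q ⟧
⟦⟧-cong p q f g = cong (if_then 1 else 0) (does-⇔ (mk⇔ f g) p q)

⟦⟧-× : {P : Set a} {Q : Set b} (p : Dec P) (q : Dec Q) → ⟦ p ×-dec q ⟧ ≡ ⟦ p ⟧ * ⟦ q ⟧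
⟦⟧-× (yes _) q = sym (*-identityˡ ⟦ q ⟧)
⟦⟧-× (no _)  q = refl

⟦⟧-⊎ : {P : Set a} {Q : Set b} (p : Dec P) (q : Dec Q) → ¬ (P × Q) → ⟦ p ⊎-dec q ⟧ ≡ ⟦ p ⟧ + ⟦ q ⟧
⟦⟧-⊎ (yes x) (yes y) ¬pq = contradiction (x , y) ¬pq
⟦⟧-⊎ (yes _) (no _)  _   = refl
⟦⟧-⊎ (no _)  q       _   = refl

⟦⟧-yes : {P : Set a} (p : Dec P) → P → ⟦ p ⟧ ≡ 1
⟦⟧-yes (yes _) _ = refl
⟦⟧-yes (no ¬x) x = contradiction x ¬x

⟦⟧-mono : {P : Set a} {Q : Set b} (p : Dec P) (q : Dec Q) → (P → Q) → ⟦ p ⟧ ≤ ⟦ q ⟧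
⟦⟧-mono (yes x) (yes _) _ = s≤s z≤n
⟦⟧-mono (yes x) (no ¬y) f = contradiction (f x) ¬y
⟦⟧-mono (no _)  q       _ = z≤n

⟦⟧-< : {P : Set a} {Q : Set b} (p : Dec P) (q : Dec Q) → ¬ P → Q → ⟦ p ⟧ < ⟦ q ⟧
⟦⟧-< (yes x) q       ¬x y = contradiction x ¬x
⟦⟧-< (no _)  (yes _) ¬x y = s≤s z≤n
⟦⟧-< (no _)  (no ¬y) ¬x y = contradiction y ¬y

length-filter : {P : Pred A ℓ} (P? : Decidable P) (xs : List A) →
  length (filter P? xs) ≡ ∑[ x ∈ xs ] ⟦ P? x ⟧
length-filter P? []       = refl
length-filter P? (x ∷ xs) with P? x
... | yes _ = cong suc (length-filter P? xs)
... | no  _ = length-filter P? xs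

-- Maps between finite sets as vectors.

lookup-ext : (u v : Vec A m) → lookup u ≗ lookup v → u ≡ v
lookup-ext u v eq = trans (sym (tabulate∘lookup u)) (trans (tabulate-cong eq) (tabulate∘lookup v))

-- Maps are represented by vectors because vectors that agree at every index are propositionally
-- equal. For functions this would require extensionality, and the arguments with duplicate-free
-- lists compare elements by `≡`.
vecs : ∀ m → List A → List (Vec A m)
vecs zero    xs = [] ∷ []
vecs (suc m) xs = cartesianProductWith _∷_ xs (vecs m xs)

∈-vecs⁺ : {xs : List A} {v : Vec A m} → (∀ i → lookup v i ∈ xs) → v ∈ vecs m xs
∈-vecs⁺ {v = []}    h = here refl
∈-vecs⁺ {v = x ∷ v} h = ∈-cartesianProductWith⁺ _∷_ (h zero) (∈-vecs⁺ (h ∘ suc))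

∈-vecs⁻ : {xs : List A} (v : Vec A m) → v ∈ vecs m xs → ∀ i → lookup v i ∈ xs
∈-vecs⁻ {xs = xs} (x ∷ v) v∈ i
  with _ , _ , x∈ , v′∈ , refl ← ∈-cartesianProductWith⁻ _∷_ xs (vecs _ xs) v∈ with i
... | zero  = x∈
... | suc j = ∈-vecs⁻ v v′∈ j

vecs-unique : ∀ m {xs : List A} → Unique xs → Unique (vecs m xs)
vecs-unique zero    xs! = All.[] ∷ []
vecs-unique (suc m) xs! = Unique.cartesianProductWith⁺ _∷_ ∷-injective xs! (vecs-unique m xs!)

maps : ∀ m n → List (Vec (Fin n) m)
maps m n = vecs m (allFin n)

∈-maps : (v : Vec (Fin n) m) → v ∈ maps m n
∈-maps v = ∈-vecs⁺ λ i → ∈-allFin (lookup v i)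

maps-unique : ∀ m n → Unique (maps m n)
maps-unique m n = vecs-unique m (Unique.allFin⁺ n)

∑-maps-reindex : (f : Vec (Fin n) m → Vec (Fin q) p) (g : Vec (Fin q) p → Vec (Fin n) m) →
  (∀ v → g (f v) ≡ v) → (∀ v → f (g v) ≡ v) →
  (w : Vec (Fin q) p → ℕ) → ∑ (maps m n) (w ∘ f) ≡ ∑ (maps p q) w
∑-maps-reindex f g gf fg =
  ∑-reindex f (maps-unique _ _) (maps-unique _ _)
    (λ {u} {v} eq → trans (sym (gf u)) (trans (cong g eq) (gf v)))
    (λ {v} _ → ∈-maps (f v)) (λ {v} _ → g v , ∈-maps (g v) , sym (fg v))

-- Homomorphism counts as sums over vectors.

module _ (F : Graph m) (G : Graph n) where

  isHom-≗ : {f g : Fin m → Fin n} → f ≗ g → IsHom F G f → IsHom F G g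
  isHom-≗ eq h u v e = subst₂ (Edge G) (eq u) (eq v) (h u v e)

  isHomᵛ? : (v : Vec (Fin n) m) → Dec (IsHom F G (lookup v))
  isHomᵛ? v = isHom? F G (lookup v)

  hom≡∑ : hom F G ≡ ∑[ v ∈ maps m n ] ⟦ isHomᵛ? v ⟧
  hom≡∑ = begin
    hom F G
      ≡⟨ length-filter (λ i → isHom? F G (finToFun i)) (allFin (n ^ m)) ⟩
    ∑[ i ∈ allFin (n ^ m) ] ⟦ isHom? F G (finToFun i) ⟧
      ≡⟨ ∑-cong (allFin (n ^ m)) (λ i → ⟦⟧-cong (isHom? F G (finToFun i)) (isHomᵛ? (toVec i))
           (isHom-≗ (sym ∘ lookup∘tabulate (finToFun i))) (isHom-≗ (lookup∘tabulate (finToFun i)))) ⟩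
    ∑[ i ∈ allFin (n ^ m) ] ⟦ isHomᵛ? (toVec i) ⟧
      ≡⟨ ∑-reindex toVec (Unique.allFin⁺ (n ^ m)) (maps-unique m n) toVec-injective
           (λ {i} _ → ∈-maps (toVec i))
           (λ {v} _ → funToFin (lookup v) , ∈-allFin _ , toVec-surjective v) (⟦_⟧ ∘ isHomᵛ?) ⟩
    ∑[ v ∈ maps m n ] ⟦ isHomᵛ? v ⟧ ∎
    where
    open ≡-Reasoning
    toVec : Fin (n ^ m) → Vec (Fin n) m
    toVec i = tabulate (finToFun i)
    toVec-surjective : ∀ v → v ≡ toVec (funToFin (lookup v))
    toVec-surjective v = lookup-ext _ _ λ i →
      sym (trans (lookup∘tabulate (finToFun (funToFin (lookup v))) i) (finToFun-funToFin (lookup v) i))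
    -- `lookup ∘ tabulate` is only pointwise the identity, so injectivity of `toVec` rests on
    -- `funToFin` respecting pointwise equality.
    funToFin-cong : ∀ {m} {f g : Fin m → Fin n} → f ≗ g → funToFin f ≡ funToFin g
    funToFin-cong {zero}  eq = refl
    funToFin-cong {suc m} eq = cong₂ combine (eq zero) (funToFin-cong (eq ∘ suc))
    toVec-injective : ∀ {i j} → toVec i ≡ toVec j → i ≡ j
    toVec-injective {i} {j} eq = begin
      i                            ≡⟨ fromVec-toVec i ⟨
      funToFin (lookup (toVec i))  ≡⟨ cong (funToFin ∘ lookup) eq ⟩
      funToFin (lookup (toVec j))  ≡⟨ fromVec-toVec j ⟩
      j                            ∎
      where
      fromVec-toVec : ∀ i → funToFin (lookup (toVec i)) ≡ i
      fromVec-toVec i = trans (funToFin-cong {f = lookup (toVec i)} (lookup∘tabulate (finToFun i)))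
        (funToFin-finToFin {m} {n} i)

hom-cong : (F : Graph m) (G : Graph n) (F′ : Graph m) (G′ : Graph n) →
  (∀ f → IsHom F G f → IsHom F′ G′ f) → (∀ f → IsHom F′ G′ f → IsHom F G f) → hom F G ≡ hom F′ G′
hom-cong F G F′ G′ to from = begin
  hom F G                                  ≡⟨ hom≡∑ F G ⟩
  ∑[ v ∈ maps _ _ ] ⟦ isHomᵛ? F G v ⟧      ≡⟨ ∑-cong (maps _ _) (λ v →
    ⟦⟧-cong (isHomᵛ? F G v) (isHomᵛ? F′ G′ v) (to _) (from _)) ⟩
  ∑[ v ∈ maps _ _ ] ⟦ isHomᵛ? F′ G′ v ⟧    ≡⟨ hom≡∑ F′ G′ ⟨
  hom F′ G′                                ∎
  where open ≡-Reasoning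

hom-congˡ : (F F′ : Graph m) (G : Graph n) →
  (∀ u v → Edge F u v → Edge F′ u v) → (∀ u v → Edge F′ u v → Edge F u v) → hom F G ≡ hom F′ G
hom-congˡ F F′ G to from = hom-cong F G F′ G
  (λ f h u v e → h u v (from u v e)) (λ f h u v e → h u v (to u v e))

-- Precomposition with the isomorphism `f` and with its inverse `g` gives mutually inverse
-- bijections between the maps on `K` and those on `F`, and both preserve being a homomorphism.
hom-reindex : (F : Graph m) (K : Graph n) (G : Graph p) (f : Fin m → Fin n) (g : Fin n → Fin m) →
  (∀ u → g (f u) ≡ u) → (∀ u → f (g u) ≡ u) →
  IsHom F K f → IsHom K F g → hom F G ≡ hom K G
hom-reindex F K G f g gf fg f-hom g-hom = begin
  hom F G                                              ≡⟨ hom≡∑ F G ⟩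
  ∑ (maps _ _) (⟦_⟧ ∘ isHomᵛ? F G)                     ≡⟨ ∑-maps-reindex pull push pull-push push-pull _ ⟨
  ∑[ v ∈ maps _ _ ] ⟦ isHomᵛ? F G (pull v) ⟧           ≡⟨ ∑-cong (maps _ _) (λ v →
    ⟦⟧-cong (isHomᵛ? F G (pull v)) (isHomᵛ? K G v) (to v) (from v)) ⟩
  ∑[ v ∈ maps _ _ ] ⟦ isHomᵛ? K G v ⟧                  ≡⟨ hom≡∑ K G ⟨
  hom K G                                              ∎
  where
  open ≡-Reasoning
  pull = λ v → tabulate (lookup v ∘ f)
  push = λ v → tabulate (lookup v ∘ g)
  pull-push : ∀ v → push (pull v) ≡ v
  pull-push v = lookup-ext _ _ λ i → trans (lookup∘tabulate (lookup (pull v) ∘ g) i)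
    (trans (lookup∘tabulate (lookup v ∘ f) (g i)) (cong (lookup v) (fg i)))
  push-pull : ∀ v → pull (push v) ≡ v
  push-pull v = lookup-ext _ _ λ i → trans (lookup∘tabulate (lookup (push v) ∘ f) i)
    (trans (lookup∘tabulate (lookup v ∘ g) (f i)) (cong (lookup v) (gf i)))
  to : ∀ v → IsHom F G (lookup (pull v)) → IsHom K G (lookup v)
  to v h x y e = subst₂ (Edge G)
    (trans (lookup∘tabulate (lookup v ∘ f) (g x)) (cong (lookup v) (fg x)))
    (trans (lookup∘tabulate (lookup v ∘ f) (g y)) (cong (lookup v) (fg y)))
    (h (g x) (g y) (g-hom x y e))
  from : ∀ v → IsHom K G (lookup v) → IsHom F G (lookup (pull v))
  from v h x y e = subst₂ (Edge G)
    (sym (lookup∘tabulate (lookup v ∘ f) x)) (sym (lookup∘tabulate (lookup v ∘ f) y))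
    (h (f x) (f y) (f-hom x y e))

-- Graphs from decidable relations; edges of the full complement.

graph : {R : Fin n → Fin n → Set} → (∀ u v → Dec (R u v)) → (∀ {u v} → R u v → R v u) → Graph n
graph R? R-sym .adj u v     = does (R? u v)
graph R? R-sym .adj-sym u v = does-⇔ (mk⇔ R-sym R-sym) (R? u v) (R? v u)

does⁺ : {P : Set a} (d : Dec P) → P → T (does d)
does⁺ (yes _) _ = _
does⁺ (no ¬x) x = ¬x x

does⁻ : {P : Set a} (d : Dec P) → T (does d) → P
does⁻ (yes x) _ = x

edge? : (G : Graph n) → ∀ u v → Dec (Edge G u v)
edge? G u v = T? (adj G u v)

edge-sym : (G : Graph n) → ∀ {u v} → Edge G u v → Edge G v u
edge-sym G {u} {v} = subst T (adj-sym G u v)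

complement⁺ : (G : Graph n) → ∀ u v → ¬ Edge G u v → Edge (fullComplement G) u v
complement⁺ G u v ¬e with adj G u v
... | true  = ¬e _
... | false = _

complement⁻ : (G : Graph n) → ∀ u v → Edge (fullComplement G) u v → ¬ Edge G u v
complement⁻ G u v e with false ← adj G u v = λ ()

empty : ∀ n → Graph n
empty n .adj u v     = false
empty n .adj-sym u v = refl

-- Edge deletions and full complements: (1) ⇒ (2).

module _ (x y : Fin n) (A : Graph n) where

  AddedEdge : Fin n → Fin n → Set
  AddedEdge u v = Edge A u v ⊎ (u ≡ x × v ≡ y) ⊎ (u ≡ y × v ≡ x)

  addedEdge? : ∀ u v → Dec (AddedEdge u v)
  addedEdge? u v = edge? A u v ⊎-dec ((u ≟ x) ×-dec (v ≟ y)) ⊎-dec ((u ≟ y) ×-dec (v ≟ x))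

  addEdge : Graph n
  addEdge = graph addedEdge?
    [ inj₁ ∘ edge-sym A , inj₂ ∘ [ (λ (p , q) → inj₂ (q , p)) , (λ (p , q) → inj₁ (q , p)) ]′ ]′

module _ {m n : ℕ} (G : Graph n) where

  Avoids : (Fin m → Fin n) → List (Fin m × Fin m) → Set
  Avoids f = All.All λ (u , v) → ¬ Edge G (f u) (f v)

  homAvoids? : (A : Graph m) (B : List (Fin m × Fin m)) (f : Vec (Fin n) m) →
    Dec (IsHom A G (lookup f) × Avoids (lookup f) B)
  homAvoids? A B f =
    isHomᵛ? A G f ×-dec All.all? (λ (u , v) → ¬? (edge? G (lookup f u) (lookup f v))) B

  homAvoiding : Graph m → List (Fin m × Fin m) → ℕ
  homAvoiding A B = ∑[ f ∈ maps m n ] ⟦ homAvoids? A B f ⟧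

  homAvoiding-[] : (A : Graph m) → homAvoiding A [] ≡ hom A G
  homAvoiding-[] A = trans
    (∑-cong (maps m n) λ f → ⟦⟧-cong (homAvoids? A [] f) (isHomᵛ? A G f) proj₁ (_, All.[]))
    (sym (hom≡∑ A G))

  -- A map counted on the left sends the pair `x`, `y` either to a non-edge of `G` or to an edge. In
  -- the second case it is a homomorphism from `A` with the edge `xy` added.
  homAvoiding-∷ : (A : Graph m) (x y : Fin m) (B : List (Fin m × Fin m)) →
    homAvoiding A B ≡ homAvoiding A ((x , y) ∷ B) + homAvoiding (addEdge x y A) B
  homAvoiding-∷ A x y B = trans (∑-cong (maps m n) split) (∑-+ (maps m n) _ _)
    where
    A′ = addEdge x y A
    to : ∀ f → IsHom A G f × Avoids f B →
      (IsHom A G f × Avoids f ((x , y) ∷ B)) ⊎ (IsHom A′ G f × Avoids f B)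
    to f (h , av) with edge? G (f x) (f y)
    ... | no ¬e = inj₁ (h , ¬e All.∷ av)
    ... | yes e = inj₂ (h′ , av)
      where
      h′ : IsHom A′ G f
      h′ u v e′ with does⁻ (addedEdge? x y A u v) e′
      ... | inj₁ e″                 = h u v e″
      ... | inj₂ (inj₁ (refl , refl)) = e
      ... | inj₂ (inj₂ (refl , refl)) = edge-sym G e
    from : ∀ f → (IsHom A G f × Avoids f ((x , y) ∷ B)) ⊎ (IsHom A′ G f × Avoids f B) →
      IsHom A G f × Avoids f B
    from f (inj₁ (h , _ All.∷ av)) = h , av
    from f (inj₂ (h , av)) = (λ u v e → h u v (does⁺ (addedEdge? x y A u v) (inj₁ e))) , av
    disjoint : ∀ f → ¬ ((IsHom A G f × Avoids f ((x , y) ∷ B)) × (IsHom A′ G f × Avoids f B))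
    disjoint f ((_ , ¬e All.∷ _) , (h , _)) =
      ¬e (h x y (does⁺ (addedEdge? x y A x y) (inj₂ (inj₁ (refl , refl)))))
    split : ∀ f → ⟦ homAvoids? A B f ⟧ ≡ ⟦ homAvoids? A ((x , y) ∷ B) f ⟧ + ⟦ homAvoids? A′ B f ⟧
    split f = trans
      (⟦⟧-cong (homAvoids? A B f) (homAvoids? A ((x , y) ∷ B) f ⊎-dec homAvoids? A′ B f)
        (to (lookup f)) (from (lookup f)))
      (⟦⟧-⊎ (homAvoids? A ((x , y) ∷ B) f) (homAvoids? A′ B f) (disjoint (lookup f)))

  -- Pairs are ordered, so an edge between distinct vertices is listed in both orientations; in
  -- `homAvoiding` this merely repeats a condition.
  edges : (F : Graph m) → List (Fin m × Fin m)
  edges F = filter (λ (u , v) → edge? F u v) (cartesianProduct (allFin m) (allFin m))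

  -- Complementing loops as well makes adjacency in the complement the exact negation of adjacency
  -- in `G`, also when both ends of an edge of `F` have the same image.
  hom-complement : (F : Graph m) → hom F (fullComplement G) ≡ homAvoiding (empty m) (edges F)
  hom-complement F = trans (hom≡∑ F (fullComplement G)) (∑-cong (maps m n) λ f →
    ⟦⟧-cong (isHomᵛ? F (fullComplement G) f) (homAvoids? (empty m) (edges F) f)
      (λ h → (λ _ _ ()) , All.tabulate λ {(u , v)} uv∈ → complement⁻ G _ _
        (h u v (proj₂ (∈-filter⁻ (λ (u , v) → edge? F u v) {xs = cartesianProduct (allFin m) (allFin m)} uv∈))))
      (λ (_ , av) u v e → complement⁺ G _ _ (All.lookup av
        (∈-filter⁺ (λ (u , v) → edge? F u v) (∈-cartesianProduct⁺ (∈-allFin u) (∈-allFin v)) e))))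

module _ {𝓕 : GraphClass ℓ} (closed : ClosedUnderDeletingEdges 𝓕)
         (G : Graph p) (H : Graph q) (G≡H : HomIndist 𝓕 G H) (F : Graph m) (F∈ : 𝓕 F) where

  -- In the identity `homAvoiding-∷`, two of the three counts agree for `G` and `H` by induction on
  -- `B`, so the third does too. `A` varies in the induction, and it remains an edge deletion of `F`
  -- because only edges of `F` are added to it.
  homAvoiding-indist : ∀ B A → All.All (λ (u , v) → Edge F u v) B → IsEdgeDeletion A F →
    homAvoiding G A B ≡ homAvoiding H A B
  homAvoiding-indist [] A _ A⊆F =
    trans (homAvoiding-[] G A) (trans (G≡H A (closed F A A⊆F F∈)) (sym (homAvoiding-[] H A)))
  homAvoiding-indist ((x , y) ∷ B) A (xy∈ All.∷ B⊆F) A⊆F =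
    +-cancelʳ-≡ (homAvoiding G A′ B) _ _ (begin
      homAvoiding G A ((x , y) ∷ B) + homAvoiding G A′ B ≡⟨ homAvoiding-∷ G A x y B ⟨
      homAvoiding G A B                                  ≡⟨ homAvoiding-indist B A B⊆F A⊆F ⟩
      homAvoiding H A B                                  ≡⟨ homAvoiding-∷ H A x y B ⟩
      homAvoiding H A ((x , y) ∷ B) + homAvoiding H A′ B
        ≡⟨ cong (homAvoiding H A ((x , y) ∷ B) +_) (homAvoiding-indist B A′ B⊆F A′⊆F) ⟨
      homAvoiding H A ((x , y) ∷ B) + homAvoiding G A′ B ∎)
    where
    open ≡-Reasoning
    A′ = addEdge x y A
    A′⊆F : IsEdgeDeletion A′ F
    A′⊆F u v e with does⁻ (addedEdge? x y A u v) e
    ... | inj₁ e′                   = A⊆F u v e′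
    ... | inj₂ (inj₁ (refl , refl)) = xy∈
    ... | inj₂ (inj₂ (refl , refl)) = edge-sym F xy∈

  hom-complement-indist : hom F (fullComplement G) ≡ hom F (fullComplement H)
  hom-complement-indist = trans (hom-complement G F) (trans
    (homAvoiding-indist (edges G F) (empty _) F-edges (λ _ _ ()))
    (sym (hom-complement H F)))
    where
    F-edges : All.All (λ (u , v) → Edge F u v) (edges G F)
    F-edges = All-filter (λ (u , v) → edge? F u v) (cartesianProduct (allFin _) (allFin _))

hom-complement-involutive : (F : Graph m) (G : Graph n) →
  hom F (fullComplement (fullComplement G)) ≡ hom F G
hom-complement-involutive F G = hom-cong F (fullComplement (fullComplement G)) F G
  (λ f h u v e → subst T (not-involutive (adj G (f u) (f v))) (h u v e))
  (λ f h u v e → subst T (sym (not-involutive (adj G (f u) (f v)))) (h u v e))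

deletingEdges⇒fullComplements : {𝓕 : GraphClass ℓ} →
  ClosedUnderDeletingEdges 𝓕 → PreservedUnderFullComplements 𝓕
deletingEdges⇒fullComplements {𝓕 = 𝓕} closed G H _ _ = mk⇔ (complements G H) λ G≡H F F∈ →
  trans (sym (hom-complement-involutive F G))
    (trans (complements (fullComplement G) (fullComplement H) G≡H F F∈)
      (hom-complement-involutive F H))
  where
  -- Loops are allowed here, since the converse direction applies this to full complements of simple
  -- graphs and then cancels the double complement.
  complements : ∀ {p q} (G : Graph p) (H : Graph q) →
    HomIndist 𝓕 G H → HomIndist 𝓕 (fullComplement G) (fullComplement H)
  complements G H G≡H F F∈ = hom-complement-indist closed G H G≡H F F∈

-- Categorical products, pullbacks and intersections.

Simple-edgeDeletion : (K L : Graph n) → IsEdgeDeletion L K → Simple K → Simple L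
Simple-edgeDeletion K L L⊆K K-simple v e = K-simple v (L⊆K v v e)

module _ (G : Graph p) (X : Graph k) where

  ⊗-edge? : ∀ x y →
    Dec (Edge G (quotient k x) (quotient k y) × Edge X (remainder {p} k x) (remainder {p} k y))
  ⊗-edge? x y =
    edge? G (quotient k x) (quotient k y) ×-dec edge? X (remainder {p} k x) (remainder {p} k y)

  -- The categorical product, with `Fin (p * k)` in the role of `Fin p × Fin k`.
  _⊗_ : Graph (p * k)
  _⊗_ = graph ⊗-edge? λ (e , e′) → edge-sym G e , edge-sym X e′

  -- A loop of the product projects to a loop of `X`. Hence the product is simple even when `G` is a
  -- full complement.
  ⊗-simple : Simple X → Simple _⊗_
  ⊗-simple X-simple x e = X-simple _ (proj₂ (does⁻ (⊗-edge? x x) e))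

-- The graph φ⁻¹(L) of the outline. For injective `f` it is a copy of an induced subgraph, and for
-- bijective `f` a relabelling.
pullback : (Fin k → Fin n) → Graph n → Graph k
pullback f X .adj u v     = adj X (f u) (f v)
pullback f X .adj-sym u v = adj-sym X (f u) (f v)

module _ (K L : Graph n) where

  ∩-edge? : ∀ u v → Dec (Edge K u v × Edge L u v)
  ∩-edge? u v = edge? K u v ×-dec edge? L u v

  _∩_ : Graph n
  _∩_ = graph ∩-edge? λ (e , e′) → edge-sym K e , edge-sym L e′

combineᵛ : Vec (Fin p) m → Vec (Fin k) m → Vec (Fin (p * k)) m
combineᵛ = zipWith combine

quotient-combineᵛ : (g : Vec (Fin p) m) (φ : Vec (Fin k) m) → ∀ i →
  quotient k (lookup (combineᵛ g φ) i) ≡ lookup g i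
quotient-combineᵛ {k = k} g φ i =
  trans (cong (quotient k) (lookup-zipWith combine i g φ)) (cong proj₁ (remQuot-combine (lookup g i) _))

remainder-combineᵛ : (g : Vec (Fin p) m) (φ : Vec (Fin k) m) → ∀ i →
  remainder {p} k (lookup (combineᵛ g φ) i) ≡ lookup φ i
remainder-combineᵛ {p = p} {k = k} g φ i =
  trans (cong (remainder {p} k) (lookup-zipWith combine i g φ)) (cong proj₂ (remQuot-combine (lookup g i) _))

-- A map into a product is a pair of maps. The second component `φ` is summed outermost so that it
-- can be fixed as a colouring in `hom-⇓`.
∑-maps-* : ∀ m p k (w : Vec (Fin (p * k)) m → ℕ) →
  ∑ (maps m (p * k)) w ≡ ∑[ φ ∈ maps m k ] ∑[ g ∈ maps m p ] w (combineᵛ g φ)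
∑-maps-* m p k w = trans
  (sym (∑-reindex (λ (φ , g) → combineᵛ g φ)
    (Unique.cartesianProduct⁺ (maps-unique m k) (maps-unique m p)) (maps-unique m (p * k))
    injective (λ _ → ∈-maps _)
    (λ {v} _ → (Vec.map (remainder {p} k) v , Vec.map (quotient {p} k) v) ,
      ∈-cartesianProduct⁺ (∈-maps _) (∈-maps _) , surjective v) w))
  (∑-cartesianProduct (maps m k) (maps m p) (λ (φ , g) → w (combineᵛ g φ)))
  where
  injective : ∀ {φg φg′ : Vec (Fin k) m × Vec (Fin p) m} →
    combineᵛ (proj₂ φg) (proj₁ φg) ≡ combineᵛ (proj₂ φg′) (proj₁ φg′) → φg ≡ φg′
  injective {φ , g} {φ′ , g′} eq = cong₂ _,_
    (lookup-ext φ φ′ λ i → trans (sym (remainder-combineᵛ g φ i))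
      (trans (cong (λ v → remainder {p} k (lookup v i)) eq) (remainder-combineᵛ g′ φ′ i)))
    (lookup-ext g g′ λ i → trans (sym (quotient-combineᵛ g φ i))
      (trans (cong (λ v → quotient {p} k (lookup v i)) eq) (quotient-combineᵛ g′ φ′ i)))
  surjective : ∀ v → v ≡ combineᵛ (Vec.map (quotient {p} k) v) (Vec.map (remainder {p} k) v)
  surjective v = lookup-ext _ _ λ i → sym (begin
    lookup (combineᵛ g φ) i             ≡⟨ lookup-zipWith combine i g φ ⟩
    combine (lookup g i) (lookup φ i)
      ≡⟨ cong₂ combine (lookup-map i (quotient {p} k) v) (lookup-map i (remainder {p} k) v) ⟩
    combine (quotient {p} k (lookup v i)) (remainder {p} k (lookup v i))
      ≡⟨ combine-remQuot {p} k (lookup v i) ⟩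
    lookup v i                          ∎)
    where
    open ≡-Reasoning
    g : Vec (Fin p) m
    g = Vec.map (quotient {p} k) v
    φ : Vec (Fin k) m
    φ = Vec.map (remainder {p} k) v

module _ (G : Graph p) (X : Graph k) (g : Vec (Fin p) m) (φ : Vec (Fin k) m) (u v : Fin m) where

  private
    x y : Fin (p * k)
    x = lookup (combineᵛ g φ) u
    y = lookup (combineᵛ g φ) v

  ⊗-edge⁻ : Edge (G ⊗ X) x y → Edge G (lookup g u) (lookup g v) × Edge X (lookup φ u) (lookup φ v)
  ⊗-edge⁻ e with e₁ , e₂ ← does⁻ (⊗-edge? G X x y) e =
    subst₂ (Edge G) (quotient-combineᵛ g φ u) (quotient-combineᵛ g φ v) e₁ ,
    subst₂ (Edge X) (remainder-combineᵛ g φ u) (remainder-combineᵛ g φ v) e₂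

  ⊗-edge⁺ : Edge G (lookup g u) (lookup g v) → Edge X (lookup φ u) (lookup φ v) → Edge (G ⊗ X) x y
  ⊗-edge⁺ e₁ e₂ = does⁺ (⊗-edge? G X x y)
    ( subst₂ (Edge G) (sym (quotient-combineᵛ g φ u)) (sym (quotient-combineᵛ g φ v)) e₁
    , subst₂ (Edge X) (sym (remainder-combineᵛ g φ u)) (sym (remainder-combineᵛ g φ v)) e₂)

module _ (F : Graph m) (G : Graph p) (X : Graph k) where

  hom-⊗ : hom F (G ⊗ X) ≡ hom F X * hom F G
  hom-⊗ = begin
    hom F (G ⊗ X)
      ≡⟨ hom≡∑ F (G ⊗ X) ⟩
    ∑ (maps m (p * k)) (⟦_⟧ ∘ isHomᵛ? F (G ⊗ X))
      ≡⟨ ∑-maps-* m p k (⟦_⟧ ∘ isHomᵛ? F (G ⊗ X)) ⟩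
    ∑[ φ ∈ maps m k ] ∑[ g ∈ maps m p ] ⟦ isHomᵛ? F (G ⊗ X) (combineᵛ g φ) ⟧
      ≡⟨ ∑-cong (maps m k) (λ φ → ∑-cong (maps m p) λ g → factor g φ) ⟩
    ∑[ φ ∈ maps m k ] ∑[ g ∈ maps m p ] (⟦ isHomᵛ? F X φ ⟧ * ⟦ isHomᵛ? F G g ⟧)
      ≡⟨ ∑-cong (maps m k) (λ φ → ∑-*ˡ (maps m p) ⟦ isHomᵛ? F X φ ⟧ (⟦_⟧ ∘ isHomᵛ? F G)) ⟩
    ∑[ φ ∈ maps m k ] (⟦ isHomᵛ? F X φ ⟧ * ∑ (maps m p) (⟦_⟧ ∘ isHomᵛ? F G))
      ≡⟨ ∑-*ʳ (maps m k) (⟦_⟧ ∘ isHomᵛ? F X) _ ⟩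
    ∑ (maps m k) (⟦_⟧ ∘ isHomᵛ? F X) * ∑ (maps m p) (⟦_⟧ ∘ isHomᵛ? F G)
      ≡⟨ cong₂ _*_ (hom≡∑ F X) (hom≡∑ F G) ⟨
    hom F X * hom F G ∎
    where
    open ≡-Reasoning
    factor : ∀ g φ →
      ⟦ isHomᵛ? F (G ⊗ X) (combineᵛ g φ) ⟧ ≡ ⟦ isHomᵛ? F X φ ⟧ * ⟦ isHomᵛ? F G g ⟧
    factor g φ = trans
      (⟦⟧-cong (isHomᵛ? F (G ⊗ X) (combineᵛ g φ)) (isHomᵛ? F X φ ×-dec isHomᵛ? F G g)
        (λ h → (λ u v e → proj₂ (⊗-edge⁻ G X g φ u v (h u v e))) ,
               (λ u v e → proj₁ (⊗-edge⁻ G X g φ u v (h u v e))))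
        (λ (h₂ , h₁) u v e → ⊗-edge⁺ G X g φ u v (h₁ u v e) (h₂ u v e)))
      (⟦⟧-× (isHomᵛ? F X φ) (isHomᵛ? F G g))

-- (g , c) and (h , d) are adjacent in G ⇓ X iff gh is an edge of G or cd is not an
-- edge of X.
_⇓_ : Graph p → Graph k → Graph (p * k)
G ⇓ X = fullComplement (fullComplement G ⊗ X)

-- Fix the colouring `φ` by vertices of `X`. An edge of `F` whose colours are not adjacent in `X` is
-- mapped to an edge whatever the component in `G` does; the other edges of `F` must be mapped to
-- edges of `G`.
hom-⇓ : (F : Graph m) (G : Graph p) (X : Graph k) →
  hom F (G ⇓ X) ≡ ∑[ φ ∈ maps m k ] hom (F ∩ pullback (lookup φ) X) G
hom-⇓ {m} {p} {k} F G X = begin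
  hom F (G ⇓ X)
    ≡⟨ hom≡∑ F (G ⇓ X) ⟩
  ∑ (maps m (p * k)) (⟦_⟧ ∘ isHomᵛ? F (G ⇓ X))
    ≡⟨ ∑-maps-* m p k (⟦_⟧ ∘ isHomᵛ? F (G ⇓ X)) ⟩
  ∑[ φ ∈ maps m k ] ∑[ g ∈ maps m p ] ⟦ isHomᵛ? F (G ⇓ X) (combineᵛ g φ) ⟧
    ≡⟨ ∑-cong (maps m k) (λ φ → ∑-cong (maps m p) λ g →
         ⟦⟧-cong (isHomᵛ? F (G ⇓ X) (combineᵛ g φ)) (isHomᵛ? (F↾ φ) G g) (to g φ) (from g φ)) ⟩
  ∑[ φ ∈ maps m k ] ∑[ g ∈ maps m p ] ⟦ isHomᵛ? (F↾ φ) G g ⟧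
    ≡⟨ ∑-cong (maps m k) (λ φ → hom≡∑ (F↾ φ) G) ⟨
  ∑[ φ ∈ maps m k ] hom (F↾ φ) G ∎
  where
  open ≡-Reasoning
  F↾ : Vec (Fin k) m → Graph m
  F↾ φ = F ∩ pullback (lookup φ) X
  to : ∀ g φ → IsHom F (G ⇓ X) (lookup (combineᵛ g φ)) → IsHom (F↾ φ) G (lookup g)
  to g φ h u v e with e₁ , e₂ ← does⁻ (∩-edge? F (pullback (lookup φ) X) u v) e
                 with edge? G (lookup g u) (lookup g v)
  ... | yes e′ = e′
  ... | no ¬e′ = contradiction
    (⊗-edge⁺ (fullComplement G) X g φ u v (complement⁺ G _ _ ¬e′) e₂)
    (complement⁻ (fullComplement G ⊗ X) _ _ (h u v e₁))
  from : ∀ g φ → IsHom (F↾ φ) G (lookup g) → IsHom F (G ⇓ X) (lookup (combineᵛ g φ))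
  from g φ h u v e = complement⁺ (fullComplement G ⊗ X) _ _ λ e′ →
    let e₁ , e₂ = ⊗-edge⁻ (fullComplement G) X g φ u v e′
    in complement⁻ G _ _ e₁ (h u v (does⁺ (∩-edge? F (pullback (lookup φ) X) u v) (e , e₂)))

lookup-injective : {xs : List A} → Unique xs → ∀ {i j} → List.lookup xs i ≡ List.lookup xs j → i ≡ j
lookup-injective (x∉ ∷ _)   {zero}  {zero}  eq = refl
lookup-injective (x∉ ∷ _)   {zero}  {suc j} eq = contradiction eq (All.lookup x∉ (∈-lookup j))
lookup-injective (x∉ ∷ _)   {suc i} {zero}  eq = contradiction (sym eq) (All.lookup x∉ (∈-lookup i))
lookup-injective (_ ∷ xs!)  {suc i} {suc j} eq = cong suc (lookup-injective xs! eq)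

∑-vecs-lookup : ∀ m {xs : List A} → Unique xs → (w : Vec A m → ℕ) →
  ∑ (maps m (length xs)) (w ∘ Vec.map (List.lookup xs)) ≡ ∑ (vecs m xs) w
∑-vecs-lookup m {xs} xs! = ∑-reindex (Vec.map (List.lookup xs)) (maps-unique m (length xs))
  (vecs-unique m xs!)
  (λ {u} {v} eq → lookup-ext u v λ i → lookup-injective xs!
    (trans (sym (lookup-map i _ u)) (trans (cong (λ v → lookup v i) eq) (lookup-map i _ v))))
  (λ {v} _ → ∈-vecs⁺ λ i → subst (_∈ xs) (sym (lookup-map i _ v)) (∈-lookup (lookup v i)))
  (λ {v} v∈ → tabulate (index ∘ ∈-vecs⁻ v v∈) , ∈-maps _ , lookup-ext _ _ λ i → sym (trans
    (lookup-map i _ (tabulate (index ∘ ∈-vecs⁻ v v∈)))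
    (trans (cong (List.lookup xs) (lookup∘tabulate (index ∘ ∈-vecs⁻ v v∈) i))
      (sym (lookup-index (∈-vecs⁻ v v∈ i))))))

-- The vertices of the induced subgraph L[xs] are the positions in `xs`. Since `xs` has no
-- repetitions, colourings by positions correspond to colourings by vertices of `L` that lie in
-- `xs`.
hom-⇓-pullback : {xs : List (Fin n)} → Unique xs → (F : Graph m) (G : Graph p) (L : Graph n) →
  hom F (G ⇓ pullback (List.lookup xs) L) ≡ ∑[ φ ∈ vecs m xs ] hom (F ∩ pullback (lookup φ) L) G
hom-⇓-pullback {m = m} {xs = xs} xs! F G L = begin
  hom F (G ⇓ L[xs])
    ≡⟨ hom-⇓ F G L[xs] ⟩
  ∑[ φ ∈ maps m (length xs) ] hom (F ∩ pullback (lookup φ) L[xs]) G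
    ≡⟨ ∑-cong (maps m (length xs)) (λ φ → hom-congˡ (F ∩ pullback (lookup φ) L[xs])
         (F ∩ pullback (lookup (Vec.map (List.lookup xs) φ)) L) G
         (λ u v → subst₂ (λ x y → T (adj F u v ∧ adj L x y))
           (sym (lookup-map u _ φ)) (sym (lookup-map v _ φ)))
         (λ u v → subst₂ (λ x y → T (adj F u v ∧ adj L x y)) (lookup-map u _ φ) (lookup-map v _ φ))) ⟩
  ∑[ φ ∈ maps m (length xs) ] hom (F ∩ pullback (lookup (Vec.map (List.lookup xs) φ)) L) G
    ≡⟨ ∑-vecs-lookup m xs! (λ φ → hom (F ∩ pullback (lookup φ) L) G) ⟩
  ∑[ φ ∈ vecs m xs ] hom (F ∩ pullback (lookup φ) L) G ∎
  where
  open ≡-Reasoning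
  L[xs] = pullback (List.lookup xs) L

-- Indistinguishability under products and complements.

hom-self-nonZero : (K : Graph n) → NonZero (hom K K)
hom-self-nonZero {n} K = >-nonZero (begin-strict
  0                              <⟨ z<s ⟩
  1                              ≡⟨ ⟦⟧-yes (isHomᵛ? K K idᵛ) id-isHom ⟨
  ⟦ isHomᵛ? K K idᵛ ⟧            ≤⟨ ∈⇒≤∑ (⟦_⟧ ∘ isHomᵛ? K K) (∈-maps idᵛ) ⟩
  ∑ (maps n n) (⟦_⟧ ∘ isHomᵛ? K K) ≡⟨ hom≡∑ K K ⟨
  hom K K                        ∎)
  where
  open ≤-Reasoning
  idᵛ : Vec (Fin n) n
  idᵛ = tabulate id
  id-isHom : IsHom K K (lookup idᵛ)
  id-isHom u v = subst₂ (Edge K) (sym (lookup∘tabulate id u)) (sym (lookup∘tabulate id v))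

module _ {𝓕 : GraphClass ℓ} where

  HomIndist-⊗ : (G : Graph p) (H : Graph q) (X : Graph k) →
    HomIndist 𝓕 G H → HomIndist 𝓕 (G ⊗ X) (H ⊗ X)
  HomIndist-⊗ G H X G≡H F F∈ =
    trans (hom-⊗ F G X) (trans (cong (hom F X *_) (G≡H F F∈)) (sym (hom-⊗ F H X)))

  -- G and H may have loops: multiplying them by K makes them simple.
  cl-indist : (K : Graph k) → cl 𝓕 K → (G : Graph p) (H : Graph q) →
    HomIndist 𝓕 G H → hom K G ≡ hom K H
  cl-indist K (K-simple , K-cl) G H G≡H =
    *-cancelˡ-≡ (hom K G) (hom K H) (hom K K) ⦃ hom-self-nonZero K ⦄ (begin
      hom K K * hom K G ≡⟨ hom-⊗ K G K ⟨
      hom K (G ⊗ K)     ≡⟨ K-cl (G ⊗ K) (H ⊗ K) (⊗-simple G K K-simple) (⊗-simple H K K-simple)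
                             (HomIndist-⊗ G H K G≡H) ⟩
      hom K (H ⊗ K)     ≡⟨ hom-⊗ K H K ⟩
      hom K K * hom K H ∎)
    where open ≡-Reasoning

  -- `_⇓_` complements, multiplies and complements again, and each operation preserves
  -- indistinguishability. Simplicity of `X` makes the products simple, so that `preserved` applies
  -- a second time. Every vertex of the resulting graphs has a loop, which is why `cl-indist` has to
  -- handle loops.
  HomIndist-⇓ : PreservedUnderFullComplements 𝓕 →
    (G : Graph p) (H : Graph q) (X : Graph k) → Simple G → Simple H → Simple X →
    HomIndist 𝓕 G H → HomIndist 𝓕 (G ⇓ X) (H ⇓ X)
  HomIndist-⇓ preserved G H X G-simple H-simple X-simple G≡H =
    Equivalence.to
      (preserved (fullComplement G ⊗ X) (fullComplement H ⊗ X)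
        (⊗-simple (fullComplement G) X X-simple) (⊗-simple (fullComplement H) X X-simple))
      (HomIndist-⊗ (fullComplement G) (fullComplement H) X
        (Equivalence.to (preserved G H G-simple H-simple) G≡H))

-- Inclusion-exclusion over the image of a map.

module _ {m n : ℕ} where

  Covers : List (Fin n) → Vec (Fin n) m → Set
  Covers J φ = All.All (λ j → ∃ λ i → lookup φ i ≡ j) J

  hits? : (j : Fin n) (φ : Vec (Fin n) m) → Dec (∃ λ i → lookup φ i ≡ j)
  hits? j φ = any? λ i → lookup φ i ≟ j

  covers? : ∀ J → Decidable (Covers J)
  covers? J φ = All.all? (λ j → hits? j φ) J

  -- Interpolates between all maps into `xs`, for empty `J`, and the bijections, for `J` and `xs`
  -- both `allFin n` and `m` equal to `n`.
  coverings : List (Fin n) → List (Fin n) → List (Vec (Fin n) m)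
  coverings J xs = filter (covers? J) (vecs m xs)

  coverings-unique : ∀ J {xs} → Unique xs → Unique (coverings J xs)
  coverings-unique J xs! = Unique.filter⁺ (covers? J) (vecs-unique m xs!)

  remove : Fin n → List (Fin n) → List (Fin n)
  remove j = filter λ x → ¬? (x ≟ j)

  remove-unique : ∀ j {xs} → Unique xs → Unique (remove j xs)
  remove-unique j = Unique.filter⁺ λ x → ¬? (x ≟ j)

  -- A map into `xs` that covers `J` either hits `j` as well or takes its values in `xs` without
  -- `j`. The additive form avoids subtraction of natural numbers.
  ∑-coverings-∷ : ∀ j J {xs} → Unique xs → (w : Vec (Fin n) m → ℕ) →
    ∑ (coverings (j ∷ J) xs) w + ∑ (coverings J (remove j xs)) w ≡ ∑ (coverings J xs) w
  ∑-coverings-∷ j J {xs} xs! w = trans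
    (cong₂ _+_ (∑-↭ hitting w) (∑-↭ missing w))
    (∑-partition (hits? j) (coverings J xs) w)
    where
    hitting : coverings (j ∷ J) xs ↭ filter (hits? j) (coverings J xs)
    hitting = unique∧set⇒↭ (coverings-unique (j ∷ J) xs!)
      (Unique.filter⁺ (hits? j) (coverings-unique J xs!)) to from
      where
      to : ∀ {φ} → φ ∈ coverings (j ∷ J) xs → φ ∈ filter (hits? j) (coverings J xs)
      to φ∈ with φ∈xs , hit All.∷ cov ← ∈-filter⁻ (covers? (j ∷ J)) {xs = vecs m xs} φ∈ =
        ∈-filter⁺ (hits? j) (∈-filter⁺ (covers? J) φ∈xs cov) hit
      from : ∀ {φ} → φ ∈ filter (hits? j) (coverings J xs) → φ ∈ coverings (j ∷ J) xs
      from φ∈ with φ∈J , hit ← ∈-filter⁻ (hits? j) {xs = coverings J xs} φ∈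
              with φ∈xs , cov ← ∈-filter⁻ (covers? J) {xs = vecs m xs} φ∈J =
        ∈-filter⁺ (covers? (j ∷ J)) φ∈xs (hit All.∷ cov)
    missing : coverings J (remove j xs) ↭ filter (¬? ∘ hits? j) (coverings J xs)
    missing = unique∧set⇒↭ (coverings-unique J (remove-unique j xs!))
      (Unique.filter⁺ (¬? ∘ hits? j) (coverings-unique J xs!)) to from
      where
      to : ∀ {φ} → φ ∈ coverings J (remove j xs) → φ ∈ filter (¬? ∘ hits? j) (coverings J xs)
      to {φ} φ∈ with φ∈rem , cov ← ∈-filter⁻ (covers? J) {xs = vecs m (remove j xs)} φ∈ =
        ∈-filter⁺ (¬? ∘ hits? j)
          (∈-filter⁺ (covers? J) (∈-vecs⁺ (proj₁ ∘ mem)) cov)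
          (λ (i , eq) → proj₂ (mem i) eq)
        where
        mem : ∀ i → lookup φ i ∈ xs × lookup φ i ≢ j
        mem i = ∈-filter⁻ (λ x → ¬? (x ≟ j)) (∈-vecs⁻ φ φ∈rem i)
      from : ∀ {φ} → φ ∈ filter (¬? ∘ hits? j) (coverings J xs) → φ ∈ coverings J (remove j xs)
      from {φ} φ∈ with φ∈J , miss ← ∈-filter⁻ (¬? ∘ hits? j) {xs = coverings J xs} φ∈
                  with φ∈xs , cov ← ∈-filter⁻ (covers? J) {xs = vecs m xs} φ∈J =
        ∈-filter⁺ (covers? J)
          (∈-vecs⁺ λ i → ∈-filter⁺ (λ x → ¬? (x ≟ j)) (∈-vecs⁻ φ φ∈xs i) (λ eq → miss (i , eq))) cov

  -- Induction on `J`, cancelling the maps that miss `j`. These take values in a smaller list, so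
  -- equality of the full sums is assumed for every duplicate-free `xs`.
  ∑-coverings-cong : (w w′ : Vec (Fin n) m → ℕ) →
    (∀ {xs} → Unique xs → ∑ (vecs m xs) w ≡ ∑ (vecs m xs) w′) →
    ∀ J {xs} → Unique xs → ∑ (coverings J xs) w ≡ ∑ (coverings J xs) w′
  ∑-coverings-cong w w′ eq [] {xs} xs! = begin
    ∑ (coverings [] xs) w  ≡⟨ ∑-↭ all w ⟩
    ∑ (vecs m xs) w        ≡⟨ eq xs! ⟩
    ∑ (vecs m xs) w′       ≡⟨ ∑-↭ all w′ ⟨
    ∑ (coverings [] xs) w′ ∎
    where
    open ≡-Reasoning
    all : coverings [] xs ↭ vecs m xs
    all = unique∧set⇒↭ (coverings-unique [] xs!) (vecs-unique m xs!)
      (λ φ∈ → proj₁ (∈-filter⁻ (covers? []) φ∈)) (λ φ∈ → ∈-filter⁺ (covers? []) φ∈ All.[])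
  ∑-coverings-cong w w′ eq (j ∷ J) {xs} xs! =
    +-cancelʳ-≡ (∑ (coverings J (remove j xs)) w) _ _ (begin
      ∑ (coverings (j ∷ J) xs) w + ∑ (coverings J (remove j xs)) w
        ≡⟨ ∑-coverings-∷ j J xs! w ⟩
      ∑ (coverings J xs) w
        ≡⟨ ∑-coverings-cong w w′ eq J xs! ⟩
      ∑ (coverings J xs) w′
        ≡⟨ ∑-coverings-∷ j J xs! w′ ⟨
      ∑ (coverings (j ∷ J) xs) w′ + ∑ (coverings J (remove j xs)) w′
        ≡⟨ cong (∑ (coverings (j ∷ J) xs) w′ +_)
             (∑-coverings-cong w w′ eq J (remove-unique j xs!)) ⟨
      ∑ (coverings (j ∷ J) xs) w′ + ∑ (coverings J (remove j xs)) w ∎)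
    where open ≡-Reasoning

-- If c < c′, say, then w ≤ w′ pointwise and strictly at y, so the sums would differ.
∑-≡⇒≡ : {xs : List A} (w w′ : A → ℕ) {c c′ : ℕ} →
  (∀ {x} → x ∈ xs → w x ≡ w′ x ⊎ (w x ≡ c × w′ x ≡ c′)) →
  ∀ {y} → y ∈ xs → w y ≡ c → w′ y ≡ c′ → ∑ xs w ≡ ∑ xs w′ → c ≡ c′
∑-≡⇒≡ {xs = xs} w w′ {c} {c′} alt y∈ refl refl eq with <-cmp c c′
... | tri≈ _ c≡c′ _ = c≡c′
... | tri< c<c′ _ _ = contradiction eq (<⇒≢ (∑-mono-< xs le y∈ c<c′))
  where
  le : ∀ {x} → x ∈ xs → w x ≤ w′ x
  le x∈ with alt x∈
  ... | inj₁ e        = ≤-reflexive e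
  ... | inj₂ (e , e′) = subst₂ _≤_ (sym e) (sym e′) (<⇒≤ c<c′)
... | tri> _ _ c>c′ = contradiction (sym eq) (<⇒≢ (∑-mono-< xs ge y∈ c>c′))
  where
  ge : ∀ {x} → x ∈ xs → w′ x ≤ w x
  ge x∈ with alt x∈
  ... | inj₁ e        = ≤-reflexive (sym e)
  ... | inj₂ (e , e′) = subst₂ _≤_ (sym e′) (sym e) (<⇒≤ c>c′)

-- Bijections and the number of edges.

section⇒retraction : (f g : Fin n → Fin n) → (∀ j → f (g j) ≡ j) → ∀ i → g (f i) ≡ i
section⇒retraction {suc n} f g fg i with g (f i) ≟ i
... | yes eq = eq
-- Pigeonhole: `g` would miss `i`, so punching out `i` would turn the injective `g` into an
-- injection from `Fin (suc n)` to `Fin n`.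
... | no gfi≢i = contradiction (injective⇒≤ {f = λ j → punchOut (missed j)} injective) (<⇒≱ (n<1+n n))
  where
  missed : ∀ j → i ≢ g j
  missed j refl = gfi≢i (cong g (fg j))
  injective : Injective _≡_ _≡_ (λ j → punchOut (missed j))
  injective {j} {j′} eq = trans (sym (fg j))
    (trans (cong f (punchOut-injective (missed j) (missed j′) eq)) (fg j′))

-- Ordered pairs are counted, so an edge between distinct vertices contributes two. It serves as the
-- measure of the induction on edges.
size : Graph n → ℕ
size {n} L = ∑[ u ∈ allFin n ] ∑[ v ∈ allFin n ] ⟦ edge? L u v ⟧

module _ (L : Graph n) (f g : Fin n → Fin n) (fg : ∀ j → f (g j) ≡ j) where

  size-pullback : size (pullback f L) ≡ size L
  size-pullback = trans
    (∑-cong (allFin n) λ u → permute λ v → ⟦ edge? L (f u) v ⟧)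
    (permute λ u → ∑[ v ∈ allFin n ] ⟦ edge? L u v ⟧)
    where
    gf : ∀ i → g (f i) ≡ i
    gf = section⇒retraction f g fg
    permute : (w : Fin n → ℕ) → ∑ (allFin n) (w ∘ f) ≡ ∑ (allFin n) w
    permute = ∑-reindex f (Unique.allFin⁺ n) (Unique.allFin⁺ n)
      (λ {i} {j} eq → trans (sym (gf i)) (trans (cong g eq) (gf j)))
      (λ _ → ∈-allFin _) (λ {j} _ → g j , ∈-allFin _ , sym (fg j))

  hom-pullback : (G : Graph p) → hom (pullback f L) G ≡ hom L G
  hom-pullback G = hom-reindex (pullback f L) L G f g (section⇒retraction f g fg) fg
    (λ _ _ e → e) (λ u v → subst₂ (Edge L) (sym (fg u)) (sym (fg v)))

-- Since adjacency is decidable, some edge of `L` outside `K` can be found. The intersection loses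
-- it and gains none.
size-∩-< : (K L : Graph n) → ¬ IsEdgeDeletion L K → size (K ∩ L) < size L
size-∩-< {n} K L L⊈K
  with u , L⊈Kᵘ ← ¬∀⟶∃¬ n (λ u → ∀ v → Edge L u v → Edge K u v)
                    (λ u → all? λ v → edge? L u v →-dec edge? K u v) L⊈K
  with v , uv∉ ← ¬∀⟶∃¬ n (λ v → Edge L u v → Edge K u v)
                    (λ v → edge? L u v →-dec edge? K u v) L⊈Kᵘ =
  ∑-mono-< (allFin n) (λ {x} _ → ∑-mono-≤ (allFin n) λ {y} _ → le x y) (∈-allFin u)
    (∑-mono-< (allFin n) (λ {y} _ → le u y) (∈-allFin v) lt)
  where
  le : ∀ x y → ⟦ edge? (K ∩ L) x y ⟧ ≤ ⟦ edge? L x y ⟧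
  le x y = ⟦⟧-mono (edge? (K ∩ L) x y) (edge? L x y) (proj₂ ∘ does⁻ (∩-edge? K L x y))
  lt : ⟦ edge? (K ∩ L) u v ⟧ < ⟦ edge? L u v ⟧
  lt = ⟦⟧-< (edge? (K ∩ L) u v) (edge? L u v)
    (λ e → uv∉ λ _ → proj₁ (does⁻ (∩-edge? K L u v) e))
    (decidable-stable (edge? L u v) λ ¬e → uv∉ λ e → contradiction e ¬e)

-- Edge deletions in the closure: (2) ⇒ (3).

module _ {𝓕 : GraphClass ℓ} (preserved : PreservedUnderFullComplements 𝓕)
         (K : Graph n) (K∈ : cl 𝓕 K) (G : Graph p) (H : Graph q)
         (G-simple : Simple G) (H-simple : Simple H) (G≡H : HomIndist 𝓕 G H) where

  ∑-colourings-indist : (L : Graph n) → Simple L → ∀ J {xs} → Unique xs →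
    ∑[ φ ∈ coverings J xs ] hom (K ∩ pullback (lookup φ) L) G ≡
    ∑[ φ ∈ coverings J xs ] hom (K ∩ pullback (lookup φ) L) H
  ∑-colourings-indist L L-simple = ∑-coverings-cong
    (λ φ → hom (K ∩ pullback (lookup φ) L) G) (λ φ → hom (K ∩ pullback (lookup φ) L) H)
    λ {xs} xs! → let L[xs] = pullback (List.lookup xs) L in begin
      ∑[ φ ∈ vecs n xs ] hom (K ∩ pullback (lookup φ) L) G  ≡⟨ hom-⇓-pullback xs! K G L ⟨
      hom K (G ⇓ L[xs])                                     ≡⟨ cl-indist K K∈ (G ⇓ L[xs]) (H ⇓ L[xs])
        (HomIndist-⇓ preserved G H L[xs] G-simple H-simple (λ i → L-simple (List.lookup xs i)) G≡H) ⟩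
      hom K (H ⇓ L[xs])                                     ≡⟨ hom-⇓-pullback xs! K H L ⟩
      ∑[ φ ∈ vecs n xs ] hom (K ∩ pullback (lookup φ) L) H  ∎
    where open ≡-Reasoning

  -- The bound `s` makes the induction on the number of edges structural. The identity colouring is
  -- the member at which `∑-≡⇒≡` requires the values `hom L G` and `hom L H` to occur.
  edgeDeletion-indist : ∀ s (L : Graph n) → size L < s → IsEdgeDeletion L K → hom L G ≡ hom L H
  edgeDeletion-indist (suc s) L size<s L⊆K = ∑-≡⇒≡
    (λ φ → hom (K∩ φ) G) (λ φ → hom (K∩ φ) H) alternative
    (∈-filter⁺ (covers? (allFin n)) (∈-maps idᵛ) (All.tabulate λ {j} _ → j , lookup∘tabulate id j))
    (hom-K∩ idᵛ id id-section id⊆K G) (hom-K∩ idᵛ id id-section id⊆K H)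
    (∑-colourings-indist L (Simple-edgeDeletion K L L⊆K (proj₁ K∈)) (allFin n) (Unique.allFin⁺ n))
    where
    K∩ : Vec (Fin n) n → Graph n
    K∩ φ = K ∩ pullback (lookup φ) L
    idᵛ : Vec (Fin n) n
    idᵛ = tabulate id
    id-section : ∀ j → lookup idᵛ j ≡ j
    id-section = lookup∘tabulate id
    id⊆K : IsEdgeDeletion (pullback (lookup idᵛ) L) K
    id⊆K u v e = L⊆K u v (subst₂ (Edge L) (id-section u) (id-section v) e)
    hom-K∩ : ∀ φ (g : Fin n → Fin n) → (∀ j → lookup φ (g j) ≡ j) →
      IsEdgeDeletion (pullback (lookup φ) L) K → ∀ {r} (X : Graph r) → hom (K∩ φ) X ≡ hom L X
    hom-K∩ φ g φg φL⊆K X = trans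
      (hom-congˡ (K∩ φ) (pullback (lookup φ) L) X
        (λ u v → proj₂ ∘ does⁻ (∩-edge? K (pullback (lookup φ) L) u v))
        (λ u v e → does⁺ (∩-edge? K (pullback (lookup φ) L) u v) (φL⊆K u v e , e)))
      (hom-pullback L (lookup φ) g φg X)
    -- Covering every vertex provides a section of `φ`, and by finiteness this section is a
    -- two-sided inverse.
    module _ {φ : Vec (Fin n) n} (φ∈ : φ ∈ coverings (allFin n) (allFin n)) where
      hit : ∀ j → ∃ λ i → lookup φ i ≡ j
      hit j = All.lookup (proj₂ (∈-filter⁻ (covers? (allFin n)) {xs = maps n n} φ∈)) (∈-allFin j)
    alternative : ∀ {φ} → φ ∈ coverings (allFin n) (allFin n) →
      hom (K∩ φ) G ≡ hom (K∩ φ) H ⊎ (hom (K∩ φ) G ≡ hom L G × hom (K∩ φ) H ≡ hom L H)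
    alternative {φ} φ∈ with isHom? (pullback (lookup φ) L) K id
    ... | yes φL⊆K = inj₂ (hom-K∩ φ (proj₁ ∘ hit φ∈) (proj₂ ∘ hit φ∈) φL⊆K G ,
                           hom-K∩ φ (proj₁ ∘ hit φ∈) (proj₂ ∘ hit φ∈) φL⊆K H)
    -- The pullback has as many edges as `L` because `φ` is bijective, and intersecting with `K`
    -- loses at least one of them.
    ... | no φL⊈K = inj₁ (edgeDeletion-indist s (K∩ φ)
      (<-≤-trans (size-∩-< K (pullback (lookup φ) L) φL⊈K)
        (≤-trans
          (≤-reflexive (size-pullback L (lookup φ) (proj₁ ∘ hit φ∈) (proj₂ ∘ hit φ∈)))
          (≤-pred size<s)))
      (λ u v → proj₁ ∘ does⁻ (∩-edge? K (pullback (lookup φ) L) u v)))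

fullComplements⇒cl-deletingEdges : {𝓕 : GraphClass ℓ} →
  PreservedUnderFullComplements 𝓕 → ClosedUnderDeletingEdges (cl 𝓕)
fullComplements⇒cl-deletingEdges preserved K L L⊆K K∈ =
  Simple-edgeDeletion K L L⊆K (proj₁ K∈) , λ G H G-simple H-simple G≡H →
    edgeDeletion-indist preserved K K∈ G H G-simple H-simple G≡H (suc (size L)) L (n<1+n _) L⊆K

-- Vertex deletions in the closure: (3) ⇒ (4).

∑-maps-insertAt : ∀ (j : Fin (suc m)) (w : Vec (Fin p) (suc m) → ℕ) →
  ∑ (maps (suc m) p) w ≡ ∑[ x ∈ allFin p ] ∑[ v ∈ maps m p ] w (insertAt v j x)
∑-maps-insertAt {m} {p} j w = trans
  (sym (∑-reindex (λ (x , v) → insertAt v j x)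
    (Unique.cartesianProduct⁺ (Unique.allFin⁺ p) (maps-unique m p)) (maps-unique (suc m) p)
    injective (λ _ → ∈-maps _)
    (λ {v} _ → (lookup v j , removeAt v j) ,
      ∈-cartesianProduct⁺ (∈-allFin _) (∈-maps _) , sym (insertAt-removeAt v j)) w))
  (∑-cartesianProduct (allFin p) (maps m p) (λ (x , v) → w (insertAt v j x)))
  where
  injective : ∀ {xv xv′ : Fin p × Vec (Fin p) m} →
    insertAt (proj₂ xv) j (proj₁ xv) ≡ insertAt (proj₂ xv′) j (proj₁ xv′) → xv ≡ xv′
  injective {x , v} {x′ , v′} eq = cong₂ _,_
    (trans (sym (insertAt-lookup v j x)) (trans (cong (λ u → lookup u j) eq) (insertAt-lookup v′ j x′)))
    (trans (sym (removeAt-insertAt v j x))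
      (trans (cong (λ u → removeAt u j) eq) (removeAt-insertAt v′ j x′)))

module _ (j : Fin (suc m)) (K : Graph (suc m)) where

  isolated-edge? : ∀ u v → Dec (Edge K u v × u ≢ j × v ≢ j)
  isolated-edge? u v = edge? K u v ×-dec ¬? (u ≟ j) ×-dec ¬? (v ≟ j)

  isolate : Graph (suc m)
  isolate = graph isolated-edge? λ (e , u≢j , v≢j) → edge-sym K e , v≢j , u≢j

  -- The isolated vertex `j` can be sent to any of the `p` vertices, independently of the rest.
  hom-isolate : (G : Graph p) → hom isolate G ≡ p * hom (pullback (punchIn j) K) G
  hom-isolate {p} G = begin
    hom isolate G
      ≡⟨ hom≡∑ isolate G ⟩
    ∑ (maps (suc m) p) (⟦_⟧ ∘ isHomᵛ? isolate G)
      ≡⟨ ∑-maps-insertAt j (⟦_⟧ ∘ isHomᵛ? isolate G) ⟩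
    ∑[ x ∈ allFin p ] ∑[ v ∈ maps m p ] ⟦ isHomᵛ? isolate G (insertAt v j x) ⟧
      ≡⟨ ∑-cong (allFin p) (λ x → ∑-cong (maps m p) λ v →
           ⟦⟧-cong (isHomᵛ? isolate G (insertAt v j x)) (isHomᵛ? K∖j G v) (to x v) (from x v)) ⟩
    ∑[ x ∈ allFin p ] ∑[ v ∈ maps m p ] ⟦ isHomᵛ? K∖j G v ⟧
      ≡⟨ ∑-const (allFin p) _ ⟩
    length (allFin p) * ∑ (maps m p) (⟦_⟧ ∘ isHomᵛ? K∖j G)
      ≡⟨ cong₂ _*_ (length-tabulate {n = p} id) (sym (hom≡∑ K∖j G)) ⟩
    p * hom K∖j G ∎
    where
    open ≡-Reasoning
    K∖j : Graph m
    K∖j = pullback (punchIn j) K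
    to : ∀ x v → IsHom isolate G (lookup (insertAt v j x)) → IsHom K∖j G (lookup v)
    to x v h a b e = subst₂ (Edge G) (insertAt-punchIn v j x a) (insertAt-punchIn v j x b)
      (h (punchIn j a) (punchIn j b)
        (does⁺ (isolated-edge? (punchIn j a) (punchIn j b)) (e , punchInᵢ≢i j a , punchInᵢ≢i j b)))
    from : ∀ x v → IsHom K∖j G (lookup v) → IsHom isolate G (lookup (insertAt v j x))
    from x v h a b e with e′ , a≢j , b≢j ← does⁻ (isolated-edge? a b) e =
      subst₂ (λ a b → Edge G (lookup (insertAt v j x) a) (lookup (insertAt v j x) b))
        (punchIn-punchOut j≢a) (punchIn-punchOut j≢b)
        (subst₂ (Edge G) (sym (insertAt-punchIn v j x (punchOut j≢a)))
          (sym (insertAt-punchIn v j x (punchOut j≢b)))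
          (h (punchOut j≢a) (punchOut j≢b)
            (subst₂ (Edge K) (sym (punchIn-punchOut j≢a)) (sym (punchIn-punchOut j≢b)) e′)))
      where
      j≢a = a≢j ∘ sym
      j≢b = b≢j ∘ sym

hom-empty : (m : ℕ) (G : Graph p) → hom (empty m) G ≡ p ^ m
hom-empty {p} m G = begin
  hom (empty m) G
    ≡⟨ length-filter isHomⁱ? (allFin (p ^ m)) ⟩
  ∑[ i ∈ allFin (p ^ m) ] ⟦ isHomⁱ? i ⟧
    ≡⟨ ∑-cong (allFin (p ^ m)) (λ i → ⟦⟧-yes (isHomⁱ? i) (λ _ _ ())) ⟩
  ∑[ i ∈ allFin (p ^ m) ] 1    ≡⟨ ∑-const (allFin (p ^ m)) 1 ⟩
  length (allFin (p ^ m)) * 1  ≡⟨ *-identityʳ _ ⟩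
  length (allFin (p ^ m))      ≡⟨ length-tabulate {n = p ^ m} id ⟩
  p ^ m                        ∎
  where
  open ≡-Reasoning
  isHomⁱ? : (i : Fin (p ^ m)) → Dec (IsHom (empty m) G (finToFun i))
  isHomⁱ? i = isHom? (empty m) G (finToFun i)

-- Recovers the number of vertices from `hom-empty`. The exponent is positive there because the
-- graph contains the vertex to be deleted.
^-injectiveˡ : ∀ m → p ^ suc m ≡ q ^ suc m → p ≡ q
^-injectiveˡ {p} {q} m eq with <-cmp p q
... | tri≈ _ p≡q _ = p≡q
... | tri< p<q _ _ = contradiction eq (<⇒≢ (^-monoˡ-< (suc m) p<q))
... | tri> _ _ q<p = contradiction (sym eq) (<⇒≢ (^-monoˡ-< (suc m) q<p))

-- Settles the case in which the factor `p` from `hom-isolate` is zero and cannot be cancelled.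
hom-no-vertices : (L : Graph m) (G H : Graph 0) → hom L G ≡ hom L H
hom-no-vertices L G H = hom-cong L G L H (λ f h u → noVertex (f u)) (λ f h u → noVertex (f u))
  where
  noVertex : {P : Set} → Fin 0 → P
  noVertex ()

module _ {𝓕 : GraphClass ℓ} (closed : ClosedUnderDeletingEdges (cl 𝓕)) where

  cl-deleteVertex : (j : Fin (suc m)) (K : Graph (suc m)) → cl 𝓕 K → cl 𝓕 (pullback (punchIn j) K)
  cl-deleteVertex {m} j K K∈ = (λ v → proj₁ K∈ (punchIn j v)) , indist
    where
    indist : ∀ {p q} (G : Graph p) (H : Graph q) → Simple G → Simple H → HomIndist 𝓕 G H →
      hom (pullback (punchIn j) K) G ≡ hom (pullback (punchIn j) K) H
    indist {p} {q} G H G-simple H-simple G≡H = go p≡q G H isolated-indist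
      where
      p≡q : p ≡ q
      p≡q = ^-injectiveˡ m (trans (sym (hom-empty (suc m) G)) (trans
        (proj₂ (closed K (empty (suc m)) (λ _ _ ()) K∈) G H G-simple H-simple G≡H)
        (hom-empty (suc m) H)))
      isolated-indist : p * hom (pullback (punchIn j) K) G ≡ q * hom (pullback (punchIn j) K) H
      isolated-indist = trans (sym (hom-isolate j K G)) (trans
        (proj₂ (closed K (isolate j K) (λ u v → proj₁ ∘ does⁻ (isolated-edge? j K u v)) K∈)
          G H G-simple H-simple G≡H)
        (hom-isolate j K H))
      -- With `p` and `q` generalised, their equality can be matched with `refl` before the split
      -- into zero and successor.
      go : ∀ {p q} → p ≡ q → (G : Graph p) (H : Graph q) →
        p * hom (pullback (punchIn j) K) G ≡ q * hom (pullback (punchIn j) K) H →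
        hom (pullback (punchIn j) K) G ≡ hom (pullback (punchIn j) K) H
      go {zero}  refl G H _  = hom-no-vertices (pullback (punchIn j) K) G H
      go {suc p} refl G H eq = *-cancelˡ-≡ _ _ (suc p) eq

  -- Relabelling `L` along `g` moves it to the vertex set of `K`, where it is an edge deletion of
  -- `K`.
  cl-bijectiveSubgraph : (K : Graph n) (L : Graph m) (f : Fin m → Fin n) (g : Fin n → Fin m) →
    (∀ u → g (f u) ≡ u) → (∀ u → f (g u) ≡ u) → IsHom L K f → cl 𝓕 K → cl 𝓕 L
  cl-bijectiveSubgraph K L f g gf fg f-hom K∈ =
    (λ v e → proj₁ K∈ (f v) (f-hom v v e)) , λ G H G-simple H-simple G≡H →
      trans (relabel G) (trans (proj₂ L′∈ G H G-simple H-simple G≡H) (sym (relabel H)))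
    where
    L′ = pullback g L
    L′∈ : cl 𝓕 L′
    L′∈ = closed K L′ (λ u v e → subst₂ (Edge K) (fg u) (fg v) (f-hom (g u) (g v) e)) K∈
    relabel : ∀ {p} (G : Graph p) → hom L G ≡ hom L′ G
    relabel G = hom-reindex L L′ G f g gf fg
      (λ u v → subst₂ (Edge L) (sym (gf u)) (sym (gf v))) (λ _ _ e → e)

  -- Induction on the number of vertices of `K`: a vertex missed by `f` is deleted, and `f` still
  -- embeds `L` into what remains. Once `f` is onto, it is a bijection.
  cl-subgraph : (K : Graph n) (L : Graph m) → IsSubgraph L K → cl 𝓕 K → cl 𝓕 L
  cl-subgraph {n} K L (f , f-injective , f-hom) K∈ with all? (λ j → any? λ i → f i ≟ j)
  ... | yes onto = cl-bijectiveSubgraph K L f (proj₁ ∘ onto)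
    (λ u → f-injective (proj₂ (onto (f u)))) (proj₂ ∘ onto) f-hom K∈
  cl-subgraph {zero} K L (f , f-injective , f-hom) K∈ | no ¬onto = contradiction (λ ()) ¬onto
  cl-subgraph {suc n} K L (f , f-injective , f-hom) K∈ | no ¬onto
    with j , missed ← ¬∀⟶∃¬ (suc n) _ (λ j → any? λ i → f i ≟ j) ¬onto =
    cl-subgraph (pullback (punchIn j) K) L
      ( (λ i → punchOut (j≢f i))
      , (λ {u} {v} eq → f-injective (punchOut-injective (j≢f u) (j≢f v) eq))
      , λ u v e → subst₂ (Edge K) (sym (punchIn-punchOut (j≢f u))) (sym (punchIn-punchOut (j≢f v)))
          (f-hom u v e))
      (cl-deleteVertex j K K∈)
    where
    j≢f : ∀ i → j ≢ f i
    j≢f i j≡fi = missed (i , sym j≡fi)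

-- The remaining implications and their assembly.

subgraphs⇒deletingEdges : {𝓕 : GraphClass ℓ} → ClosedUnderSubgraphs 𝓕 → ClosedUnderDeletingEdges 𝓕
subgraphs⇒deletingEdges closed K L L⊆K = closed K L (id , id , L⊆K)

cl-fullComplements⇒deletingEdges : {𝓕 : GraphClass ℓ} →
  PreservedUnderFullComplements (cl 𝓕) → ClosedUnderDeletingEdges (cl 𝓕)
cl-fullComplements⇒deletingEdges {𝓕 = 𝓕} preserved K L L⊆K K∈ =
  proj₁ L∈clcl , λ G H G-simple H-simple G≡H →
    proj₂ L∈clcl G H G-simple H-simple (cl-HomIndist G H G-simple H-simple G≡H)
  where
  cl-HomIndist : ∀ {p q} (G : Graph p) (H : Graph q) → Simple G → Simple H →
    HomIndist 𝓕 G H → HomIndist (cl 𝓕) G H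
  cl-HomIndist G H G-simple H-simple G≡H F F∈ = proj₂ F∈ G H G-simple H-simple G≡H
  L∈clcl : cl (cl 𝓕) L
  L∈clcl = fullComplements⇒cl-deletingEdges {𝓕 = cl 𝓕} preserved K L L⊆K
    (proj₁ K∈ , λ G H _ _ G≡H → G≡H K K∈)

theorem13 : ∀ {ℓ : Level} (𝓕 : GraphClass ℓ) → ClassOfSimpleGraphs 𝓕 →
    (ClosedUnderDeletingEdges 𝓕 → PreservedUnderFullComplements 𝓕)
    × (PreservedUnderFullComplements 𝓕 → ClosedUnderDeletingEdges (cl 𝓕))
    × (ClosedUnderDeletingEdges (cl 𝓕) ⇔ ClosedUnderSubgraphs (cl 𝓕))
    × (ClosedUnderSubgraphs (cl 𝓕) ⇔ PreservedUnderFullComplements (cl 𝓕))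
    × (ClosedUnderDeletingEdges (cl 𝓕) ⇔ PreservedUnderFullComplements (cl 𝓕))
theorem13 𝓕 _ =
    deletingEdges⇒fullComplements {𝓕 = 𝓕}
  , fullComplements⇒cl-deletingEdges {𝓕 = 𝓕}
  , mk⇔ 3⇒4 4⇒3
  , mk⇔ 4⇒5 5⇒4
  , mk⇔ 3⇒5 5⇒3
  where
  3⇒4 : ClosedUnderDeletingEdges (cl 𝓕) → ClosedUnderSubgraphs (cl 𝓕)
  3⇒4 closed = cl-subgraph {𝓕 = 𝓕} closed
  4⇒3 : ClosedUnderSubgraphs (cl 𝓕) → ClosedUnderDeletingEdges (cl 𝓕)
  4⇒3 = subgraphs⇒deletingEdges {𝓕 = cl 𝓕}
  3⇒5 : ClosedUnderDeletingEdges (cl 𝓕) → PreservedUnderFullComplements (cl 𝓕)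
  3⇒5 = deletingEdges⇒fullComplements {𝓕 = cl 𝓕}
  5⇒3 : PreservedUnderFullComplements (cl 𝓕) → ClosedUnderDeletingEdges (cl 𝓕)
  5⇒3 = cl-fullComplements⇒deletingEdges {𝓕 = 𝓕}
  4⇒5 : ClosedUnderSubgraphs (cl 𝓕) → PreservedUnderFullComplements (cl 𝓕)
  4⇒5 closed = 3⇒5 (4⇒3 closed)
  5⇒4 : PreservedUnderFullComplements (cl 𝓕) → ClosedUnderSubgraphs (cl 𝓕)
  5⇒4 preserved = 3⇒4 (5⇒3 preserved)
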